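{- Let $k\ge 1$. An $X_k$ subtree of $T_B(\infty)$ is composed of a chain of $k+1$ nodes (its rightmost chain, starting at its root, where the root is followed by its left son and each subsequent node by its right son), whose successive edges are labeled $1,2,\dots,k$, and whose $i$-th node is the root of an $X_{i-1}$ subtree for all $i$ between $1$ and $k+1$. That is, the node set of the $X_k$ subtree is the disjoint union of the node sets of these $X_{i-1}$ subtrees ($1\le i\le k+1$), and its edges are exactly the edges of these subtrees together with the $k$ edges of the chain.
   Context: A partition is a finite sequence of integers $a=(a_1,\dots,a_k)$ with $a_1\ge\dots\ge a_k>0$ (the empty partition $()$ is allowed); by convention $a_j=0$ for $j>k$. $a^{\downarrow_i}$ denotes the sequence obtained from $a$ by replacing $a_i$ by $a_i+1$. $T_B(\infty)$ is the edge-labeled rooted binary tree with root $()$ in which every node $a$ has a left son $a^{\downarrow_1}$ (edge labeled $1$), and in which a nonempty node $a$ has in addition a right son exactly when, with $p\ge 1$ denoting the number of parts of $a$ equal to $a_1$, one has $a_p-a_{p+1}=1$; the right son is then $a^{\downarrow_{p+1}}$ (edge labeled $p+1$). Its nodes are the partitions generated from the root in this way. For $k\ge 1$, an $X_k$ subtree is a subtree of $T_B(\infty)$ rooted at a node $a=(i,\dots,i,a_{k+1},\dots)$ whose first $k$ parts equal $i$ and with $a_{k+1}\le i-1$, and which is: the whole subtree of $T_B(\infty)$ rooted at $a$ if $a$ has only one son; and otherwise $a$ together with its left subtree (the whole subtree rooted at its left son, and the edge to it). An $X_0$ subtree is a single node. -}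

module Defs where

open import Data.Bool.Base using (if_then_else_)
open import Data.Empty using (⊥)
open import Data.Fin.Base using (Fin; zero; suc; toℕ; fromℕ; inject₁)
open import Data.List.Base using (List; []; _∷_; length; filter)
open import Data.List.Relation.Unary.All using (All; []; _∷_)
open import Data.List.Relation.Unary.Linked using (Linked; []; [-]; _∷_)
open import Data.Nat.Base using (ℕ; zero; suc; _∸_; _≤_; _<_; _≥_; _>_; z≤n; s≤s)
open import Data.Nat.Properties using (_≟_; ≤-trans; n≤1+n)
open import Data.Product.Base using (_×_; _,_; ∃-syntax)
open import Data.Sum.Base using (_⊎_)
open import Data.Unit.Base using (⊤)
open import Relation.Binary.Construct.Closure.ReflexiveTransitive using (Star)
open import Relation.Binary.PropositionalEquality using (_≡_; _≢_; refl)
open import Relation.Nullary using (¬_; Dec; yes; no; does)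
open import Relation.Nullary.Decidable using (_×-dec_)

-- Positions are counted from 1, and parts beyond the end are 0.
-- Position 0 does not exist: `part` returns 0 there and `_↓_` does nothing.

part : List ℕ → ℕ → ℕ
part []       _             = 0
part (x ∷ xs) zero          = 0
part (x ∷ xs) (suc zero)    = x
part (x ∷ xs) (suc (suc j)) = part xs (suc j)

infixl 6 _↓_
_↓_ : List ℕ → ℕ → List ℕ
xs       ↓ zero          = xs
[]       ↓ suc zero      = 1 ∷ []
[]       ↓ suc (suc j)   = 0 ∷ ([] ↓ suc j)
(x ∷ xs) ↓ suc zero      = suc x ∷ xs
(x ∷ xs) ↓ suc (suc j)   = x ∷ (xs ↓ suc j)

IsPartition : List ℕ → Set
IsPartition xs = Linked _≥_ xs × All (_> 0) xs

-- The proof is irrelevant, so that partitions with the same parts are equal.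
record Partition : Set where
  constructor mkPartition
  field
    parts        : List ℕ
    .isPartition : IsPartition parts

open Partition public using (parts)

↓1-isPartition : ∀ {xs} → IsPartition xs → IsPartition (xs ↓ 1)
↓1-isPartition ([]      , [])     = [-] , s≤s z≤n ∷ []
↓1-isPartition ([-]     , _ ∷ ps) = [-] , s≤s z≤n ∷ ps
↓1-isPartition (x≥y ∷ l , _ ∷ ps) = ≤-trans x≥y (n≤1+n _) ∷ l , s≤s z≤n ∷ ps

↓-isPartition : ∀ {xs} j → part xs j ∸ part xs (suc j) ≡ 1 →
                IsPartition xs → IsPartition (xs ↓ suc j)
↓-isPartition j h (l , ps) = sorted j h l , positive j h ps
  where
  ∸≡1⇒> : ∀ {m n} → m ∸ n ≡ 1 → m > n
  ∸≡1⇒> {suc m} {zero}  _ = s≤s z≤n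
  ∸≡1⇒> {suc m} {suc n} e = s≤s (∸≡1⇒> e)

  sorted-head : ∀ {x xs} → Linked _≥_ (x ∷ xs) → Linked _≥_ (suc x ∷ xs)
  sorted-head [-]       = [-]
  sorted-head (x≥y ∷ l) = ≤-trans x≥y (n≤1+n _) ∷ l

  sorted : ∀ {xs} j → part xs j ∸ part xs (suc j) ≡ 1 →
           Linked _≥_ xs → Linked _≥_ (xs ↓ suc j)
  sorted {zero ∷ _}  zero ()
  sorted {suc _ ∷ _} zero ()
  sorted (suc zero)          e [-]     = ∸≡1⇒> e ∷ [-]
  sorted (suc zero)          e (_ ∷ l) = ∸≡1⇒> e ∷ sorted-head l
  sorted (suc (suc zero))    e (r ∷ l) = r ∷ sorted 1 e l
  sorted (suc (suc (suc j))) e (r ∷ l) = r ∷ sorted (suc (suc j)) e l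

  positive : ∀ {xs} j → part xs j ∸ part xs (suc j) ≡ 1 →
             All (_> 0) xs → All (_> 0) (xs ↓ suc j)
  positive {zero ∷ _}  zero ()
  positive {suc _ ∷ _} zero ()
  positive (suc zero)    e (q ∷ [])     = q ∷ s≤s z≤n ∷ []
  positive (suc zero)    e (q ∷ _ ∷ qs) = q ∷ s≤s z≤n ∷ qs
  positive (suc (suc j)) e (q ∷ qs)     = q ∷ positive (suc j) e qs

∅ : Partition
∅ = mkPartition [] ([] , [])

-- The number p of parts equal to the first one.
#max : Partition → ℕ
#max a = length (filter (_≟ part (parts a) 1) (parts a))

HasRightSon : Partition → Set
HasRightSon a = parts a ≢ [] ×
                part (parts a) (#max a) ∸ part (parts a) (suc (#max a)) ≡ 1

hasRightSon? : ∀ a → Dec (HasRightSon a)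
hasRightSon? a = nonempty? (parts a) ×-dec (_ ≟ 1)
  where
  nonempty? : ∀ (xs : List ℕ) → Dec (xs ≢ [])
  nonempty? []       = no λ ne → ne refl
  nonempty? (x ∷ xs) = yes λ ()

leftSon : Partition → Partition
leftSon (mkPartition xs p) = mkPartition (xs ↓ 1) (↓1-isPartition p)

rightSon : (a : Partition) → HasRightSon a → Partition
rightSon a@(mkPartition xs p) (_ , e) =
  mkPartition (xs ↓ suc (#max a)) (↓-isPartition (#max a) e p)

-- Edges are triples: father, label, son.

data LeftEdge : Partition → ℕ → Partition → Set where
  left : ∀ {a} → LeftEdge a 1 (leftSon a)

data RightEdge : Partition → ℕ → Partition → Set where
  right : ∀ {a} (h : HasRightSon a) → RightEdge a (suc (#max a)) (rightSon a h)

EdgeOf : Partition → ℕ → Partition → Set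
EdgeOf a l b = LeftEdge a l b ⊎ RightEdge a l b

Son : Partition → Partition → Set
Son a b = ∃[ l ] EdgeOf a l b

record Tree : Set₁ where
  field
    Node : Partition → Set
    Edge : Partition → ℕ → Partition → Set

open Tree public

wholeSubtree : Partition → Tree
wholeSubtree a .Node b     = Star Son a b
wholeSubtree a .Edge b l c = Star Son a b × EdgeOf b l c

T-B∞ : Tree
T-B∞ = wholeSubtree ∅

singleNode : Partition → Tree
singleNode a .Node b     = b ≡ a
singleNode a .Edge _ _ _ = ⊥

withLeftSubtree : Partition → Tree
withLeftSubtree a .Node b     = b ≡ a ⊎ Node (wholeSubtree (leftSon a)) b
withLeftSubtree a .Edge b l c = (b ≡ a × LeftEdge b l c) ⊎
                                Edge (wholeSubtree (leftSon a)) b l c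

XShape : ℕ → Partition → Set
XShape zero      a = ⊤
XShape k@(suc _) a = ∃[ i ] (∀ j → 1 ≤ j → j ≤ k → part (parts a) j ≡ i)
                          × part (parts a) (suc k) < i

IsXRoot : ℕ → Partition → Set
IsXRoot k a = Node T-B∞ a × XShape k a

-- Meaningful when `IsXRoot k a`.  For k ≥ 1 the tree depends on k only
-- through that condition.
X : ℕ → Partition → Tree
X zero    a = singleNode a
X (suc _) a = if does (hasRightSon? a) then withLeftSubtree a else wholeSubtree a

-- Left for the first edge of the chain (index 0), right for the later ones.
ChainStep : ℕ → Partition → ℕ → Partition → Set
ChainStep zero    = LeftEdge
ChainStep (suc _) = RightEdge

-- The last field says that the chain cannot be extended to the right inside S.
record IsRightmostChain (S : Tree) (r : Partition) {k : ℕ}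
                        (c : Fin (suc k) → Partition) : Set where
  field
    start  : c zero ≡ r
    step   : ∀ (j : Fin k) →
             ChainStep (toℕ j) (c (inject₁ j)) (suc (toℕ j)) (c (suc j))
    inside : ∀ (j : Fin k) →
             Edge S (c (inject₁ j)) (suc (toℕ j)) (c (suc j))
    end    : ∀ l b → RightEdge (c (fromℕ k)) l b → ¬ Edge S (c (fromℕ k)) l b

{-# OPTIONS --safe #-}

-- An edge labeled l ends in a partition with exactly l largest parts, and
-- increments the last of these.  A node therefore determines its father, so
-- two nodes with a common descendant are comparable, and the left and right
-- subtrees of a node are disjoint.  From a = (i,…,i,a_{k+1},…) the chain runs
-- through (i+1,i,…,i,…), (i+1,i+1,i,…,i,…), …; a right son exists until all of
-- the first k parts have become i+1, and then the gap to the next part is at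
-- least 2.

module Submission where

open import Defs
open import Data.Bool.Base using (if_then_else_)
open import Data.Fin.Base using (Fin; zero; suc; toℕ; inject₁; fromℕ<)
open import Data.Fin.Properties
  using (toℕ-injective; toℕ-inject₁; toℕ-fromℕ; toℕ-fromℕ<; toℕ<n; toℕ≤pred[n])
open import Data.List.Base using (List; []; _∷_; length; filter)
open import Data.List.Properties using (filter-accept; filter-reject)
open import Data.List.Relation.Unary.All using (All; []; _∷_; all?)
open import Data.List.Relation.Unary.Linked as Linked using (Linked; []; [-]; _∷_; linked?)
open import Data.Nat.Base
  using (ℕ; zero; suc; _+_; _∸_; _≤_; _<_; _≥_; _>_; z≤n; s≤s; z<s)
open import Data.Nat.ListAction using (sum)
open import Data.Nat.Properties
open import Data.Product.Base using (_×_; _,_; proj₁; proj₂; ∃; ∃-syntax)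
open import Data.Sum.Base using (_⊎_; inj₁; inj₂)
open import Data.Unit.Base using (tt)
open import Function.Base using (_∘_)
open import Function.Bundles using (_⇔_; mk⇔; Equivalence)
open import Function.Construct.Identity using (⇔-id)
open import Relation.Binary.Construct.Closure.ReflexiveTransitive
  using (Star; ε; _◅_; _◅◅_)
open import Relation.Binary.Definitions using (tri<; tri≈; tri>)
open import Relation.Binary.PropositionalEquality
  using (_≡_; _≢_; refl; sym; trans; cong; subst)
open import Relation.Nullary using (¬_; Dec; does; yes; no; contradiction; recompute)
open import Relation.Nullary.Decidable using (_×-dec_)

-- Parts of an incremented sequence

part-↓-same : ∀ xs j → part (xs ↓ suc j) (suc j) ≡ suc (part xs (suc j))
part-↓-same []       zero          = refl
part-↓-same []       (suc zero)    = refl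
part-↓-same []       (suc (suc j)) = part-↓-same [] (suc j)
part-↓-same (x ∷ xs) zero          = refl
part-↓-same (x ∷ xs) (suc j)       = part-↓-same xs j

part-↓-other : ∀ xs j {m} → m ≢ suc j → part (xs ↓ suc j) m ≡ part xs m
part-↓-other []       zero    {zero}        m≢j = refl
part-↓-other []       zero    {suc zero}    m≢j = contradiction refl m≢j
part-↓-other []       zero    {suc (suc m)} m≢j = refl
part-↓-other []       (suc j) {zero}        m≢j = refl
part-↓-other []       (suc j) {suc zero}    m≢j = refl
part-↓-other []       (suc j) {suc (suc m)} m≢j =
  part-↓-other [] j (m≢j ∘ cong suc)
part-↓-other (x ∷ xs) zero    {zero}        m≢j = refl
part-↓-other (x ∷ xs) zero    {suc zero}    m≢j = contradiction refl m≢j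
part-↓-other (x ∷ xs) zero    {suc (suc m)} m≢j = refl
part-↓-other (x ∷ xs) (suc j) {zero}        m≢j = refl
part-↓-other (x ∷ xs) (suc j) {suc zero}    m≢j = refl
part-↓-other (x ∷ xs) (suc j) {suc (suc m)} m≢j =
  part-↓-other xs j (m≢j ∘ cong suc)

sum-↓ : ∀ xs j → sum (xs ↓ suc j) ≡ suc (sum xs)
sum-↓ []       zero    = refl
sum-↓ []       (suc j) = sum-↓ [] j
sum-↓ (x ∷ xs) zero    = refl
sum-↓ (x ∷ xs) (suc j) = trans (cong (x +_) (sum-↓ xs j)) (+-suc x (sum xs))

part-0 : ∀ xs → part xs 0 ≡ 0
part-0 []      = refl
part-0 (_ ∷ _) = refl

-- Positivity makes the length visible: a trailing zero part could not be told from the default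
-- value 0.
part-ext : ∀ {xs ys} → All (_> 0) xs → All (_> 0) ys →
           (∀ m → part xs m ≡ part ys m) → xs ≡ ys
part-ext []       []       e = refl
part-ext []       (q ∷ qs) e = contradiction (e 1) (<⇒≢ q)
part-ext (p ∷ ps) []       e = contradiction (sym (e 1)) (<⇒≢ p)
part-ext {x ∷ xs} {y ∷ ys} (p ∷ ps) (q ∷ qs) e with refl ← e 1 =
  cong (x ∷_) (part-ext ps qs tail-parts)
  where
  tail-parts : ∀ m → part xs m ≡ part ys m
  tail-parts (suc m) = e (suc (suc m))
  -- Position 0 does not exist, and `e 1` speaks of the heads; both sides are the default 0.
  tail-parts zero    = trans (part-0 xs) (sym (part-0 ys))

part-antitone : ∀ {xs} → Linked _≥_ xs → ∀ j → part xs (suc (suc j)) ≤ part xs (suc j)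
part-antitone []        j       = z≤n
part-antitone [-]       j       = z≤n
part-antitone (x≥y ∷ l) zero    = x≥y
part-antitone (x≥y ∷ l) (suc j) = part-antitone l j

part-positive : ∀ {xs} → All (_> 0) xs → xs ≢ [] → 0 < part xs 1
part-positive []      ne = contradiction refl ne
part-positive (p ∷ _) ne = p

-- Being a partition is decidable, so an irrelevant proof can be turned back into a usable one.
isPartition : ∀ a → IsPartition (parts a)
isPartition (mkPartition xs p) =
  recompute (linked? (λ x y → y ≤? x) xs ×-dec all? (0 <?_) xs) p

partition-ext : ∀ {a b} → parts a ≡ parts b → a ≡ b
partition-ext refl = refl

-- Decrementing that position undoes the step, but only for partitions: `[]` and `0 ∷ []` both
-- become `1 ∷ []`.
↓-injective : ∀ {a b} j → parts a ↓ suc j ≡ parts b ↓ suc j → a ≡ b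
↓-injective {a} {b} j e =
  partition-ext (part-ext (proj₂ (isPartition a)) (proj₂ (isPartition b)) same)
  where
  same : ∀ m → part (parts a) m ≡ part (parts b) m
  same m with m ≟ suc j
  ... | yes refl = suc-injective (trans (sym (part-↓-same (parts a) j))
                     (trans (cong (λ xs → part xs m) e) (part-↓-same (parts b) j)))
  ... | no m≢j   = trans (sym (part-↓-other (parts a) j m≢j))
                     (trans (cong (λ xs → part xs m) e) (part-↓-other (parts b) j m≢j))

-- Number of largest parts

filter-≟-empty : ∀ {xs i} → Linked _≥_ xs → part xs 1 < i → filter (_≟ i) xs ≡ []
filter-≟-empty []        lt = refl
filter-≟-empty [-]       lt = filter-reject (_≟ _) (<⇒≢ lt)
filter-≟-empty (x≥y ∷ l) lt =
  trans (filter-reject (_≟ _) (<⇒≢ lt)) (filter-≟-empty l (≤-<-trans x≥y lt))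

-- The value `i` is fixed in advance, because the induction passes to tails that may begin with a
-- smaller part. At the end of the list `0 < i` supplies the drop to the default 0.
filter-≟-shape : ∀ {xs i} → Linked _≥_ xs → part xs 1 ≤ i → 0 < i →
  let n = length (filter (_≟ i) xs) in
  (∀ j → 1 ≤ j → j ≤ n → part xs j ≡ i) × part xs (suc n) < i
filter-≟-shape {[]} l le pos = (λ { (suc j) _ () }) , pos
filter-≟-shape {x ∷ xs} {i} l le pos with x ≟ i
... | no x≢i rewrite filter-≟-empty l (≤∧≢⇒< le x≢i) =
  (λ { (suc j) _ () }) , ≤∧≢⇒< le x≢i
... | yes refl rewrite filter-accept (_≟ x) {x} {xs} refl =
  let eq , lt = filter-≟-shape (Linked.tail l) (part-antitone l 0) pos in
  (λ { (suc zero) _ _ → refl ; (suc (suc j)) _ (s≤s j≤) → eq (suc j) z<s j≤ }) , lt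

-- If the lengths differed, the position just after the shorter block would hold both the first part
-- and something smaller.
XShape-suc-injective : ∀ {m n a} → XShape (suc m) a → XShape (suc n) a → m ≡ n
XShape-suc-injective {m} {n} {a} (i , eq , lt) (i′ , eq′ , lt′) with <-cmp m n
... | tri≈ _ m≡n _ = m≡n
... | tri< m<n _ _ = contradiction
  (trans (eq′ (suc (suc m)) z<s (s≤s m<n)) (trans (sym (eq′ 1 z<s z<s)) (eq 1 z<s z<s)))
  (<⇒≢ lt)
... | tri> _ _ n<m = contradiction
  (trans (eq (suc (suc n)) z<s (s≤s n<m)) (trans (sym (eq 1 z<s z<s)) (eq′ 1 z<s z<s)))
  (<⇒≢ lt′)

#max-shape : ∀ a → parts a ≢ [] → ∃[ n ] #max a ≡ suc n × XShape (suc n) a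
#max-shape a ne with #max a | filter-≟-shape {parts a} (proj₁ (isPartition a)) ≤-refl
                                (part-positive (proj₂ (isPartition a)) ne)
... | zero  | _ , lt  = contradiction lt (<-irrefl refl)
... | suc n | eq , lt = n , refl , part (parts a) 1 , eq , lt

XShape-suc-nonempty : ∀ {n a} → XShape (suc n) a → parts a ≢ []
XShape-suc-nonempty {a = mkPartition [] _} (i , eq , lt) refl =
  contradiction (eq 1 z<s z<s) (<⇒≢ lt)

XShape⇒#max : ∀ {n} a → XShape (suc n) a → #max a ≡ suc n
XShape⇒#max a sh with #max-shape a (XShape-suc-nonempty {a = a} sh)
... | m , e , sh′ = trans e (cong suc (XShape-suc-injective {a = a} sh′ sh))

-- Fathers and descendants

EdgeOf-parts : ∀ {a l b} → EdgeOf a l b → parts b ≡ parts a ↓ l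
EdgeOf-parts (inj₁ left)      = refl
EdgeOf-parts (inj₂ (right _)) = refl

-- A left edge lifts the first part above all others. A right edge lifts the part after the largest
-- ones, which was one less, to their value, so the block of largest parts grows to exactly the
-- label.
EdgeOf-shape : ∀ {a l b} → EdgeOf a l b → ∃[ n ] l ≡ suc n × XShape (suc n) b
EdgeOf-shape {a} (inj₁ left) =
  0 , refl ,
  (suc (part (parts a) 1)
  , (λ { (suc zero) _ _ → part-↓-same (parts a) 0 ; (suc (suc _)) _ (s≤s ()) })
  , s≤s (≤-trans (≤-reflexive (part-↓-other (parts a) 0 λ ()))
                 (part-antitone (proj₁ (isPartition a)) 0)))
EdgeOf-shape {a} (inj₂ (right (ne , e))) with #max-shape a ne
... | n , #max≡ , i , eq , lt =
  suc n , cong suc #max≡ ,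
  subst (λ p → ∃[ i ] (∀ j → 1 ≤ j → j ≤ suc (suc n) → part (xs ↓ suc p) j ≡ i)
                    × part (xs ↓ suc p) (suc (suc (suc n))) < i)
    (sym #max≡) (i , eq′ , lt′)
  where
  xs = parts a

  i≡1+next : i ≡ suc (part xs (suc (suc n)))
  i≡1+next =
    -- `∸` is truncated; `lt` guarantees that the difference of 1 is a true one.
    trans (sym (m∸n+n≡m (<⇒≤ lt)))
      (cong (_+ part xs (suc (suc n)))
        (trans (cong (_∸ part xs (suc (suc n))) (sym (eq (suc n) z<s ≤-refl)))
          (subst (λ p → part xs p ∸ part xs (suc p) ≡ 1) #max≡ e)))

  eq′ : ∀ j → 1 ≤ j → j ≤ suc (suc n) → part (xs ↓ suc (suc n)) j ≡ i
  eq′ j 1≤j j≤ with j ≟ suc (suc n)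
  ... | yes refl = trans (part-↓-same xs (suc n)) (sym i≡1+next)
  ... | no j≢    = trans (part-↓-other xs (suc n) j≢)
                     (eq j 1≤j (≤-pred (≤∧≢⇒< j≤ j≢)))

  lt′ : part (xs ↓ suc (suc n)) (suc (suc (suc n))) < i
  lt′ = ≤-<-trans (≤-reflexive (part-↓-other xs (suc n) (1+n≢n)))
          (≤-<-trans (part-antitone (proj₁ (isPartition a)) (suc n)) lt)

EdgeOf-label : ∀ {a a′ l l′ b} → EdgeOf a l b → EdgeOf a′ l′ b → l ≡ l′
EdgeOf-label {b = b} e e′ with EdgeOf-shape e | EdgeOf-shape e′
... | _ , refl , sh | _ , refl , sh′ =
  cong suc (XShape-suc-injective {a = b} sh sh′)

-- The shape of the son reveals the label, and removing one unit at that position recovers the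
-- father.
father-unique : ∀ {a a′ b} → Son a b → Son a′ b → a ≡ a′
father-unique {b = b} (l , e) (l′ , e′) with EdgeOf-shape e | EdgeOf-shape e′
... | n , refl , sh | n′ , refl , sh′ with refl ← XShape-suc-injective {a = b} sh sh′ =
  ↓-injective n (trans (sym (EdgeOf-parts e)) (EdgeOf-parts e′))

-- The sum of the parts measures depth in the tree, which rules out cycles.
Son-sum : ∀ {a b} → Son a b → sum (parts b) ≡ suc (sum (parts a))
Son-sum {a} (_ , e) with EdgeOf-shape e
... | n , refl , _ = trans (cong sum (EdgeOf-parts e)) (sum-↓ (parts a) n)

Star-sum : ∀ {a b} → Star Son a b → sum (parts a) ≤ sum (parts b)
Star-sum ε       = ≤-refl
Star-sum (s ◅ r) = ≤-trans (≤-trans (n≤1+n _) (≤-reflexive (sym (Son-sum s)))) (Star-sum r)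

Son-acyclic : ∀ {a b} → Son a b → ¬ Star Son b a
Son-acyclic s r = <⇒≱ (≤-reflexive (sym (Son-sum s))) (Star-sum r)

-- The last step of a nonempty path into `b` leaves from its only father, which is `f`.
ancestor-of-father : ∀ {a b f} → Star Son a b → Son f b → a ≡ b ⊎ Star Son a f
ancestor-of-father ε       t = inj₁ refl
ancestor-of-father (s ◅ r) t with ancestor-of-father r t
... | inj₁ refl with refl ← father-unique s t = inj₂ ε
... | inj₂ r′   = inj₂ (s ◅ r′)

-- Climbing from `b`, both paths run through the same unique fathers until one of the two starts is
-- reached.
ancestors-comparable : ∀ {a a′ b} → Star Son a b → Star Son a′ b →
                       Star Son a a′ ⊎ Star Son a′ a
ancestors-comparable ε       r′ = inj₂ r′
ancestors-comparable (s ◅ r) r′ with ancestors-comparable r r′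
... | inj₁ q = inj₁ (s ◅ q)
... | inj₂ q with ancestor-of-father q s
...   | inj₁ refl = inj₁ (s ◅ ε)
...   | inj₂ q′   = inj₂ q′

-- A proper ancestor of `c` is an ancestor of its father `a`; for the son `b` of `a` this would be a
-- cycle.
siblings-comparable⇒≡ : ∀ {a b c} → Son a b → Son a c → Star Son b c → b ≡ c
siblings-comparable⇒≡ s t r with ancestor-of-father r t
... | inj₁ b≡c = b≡c
... | inj₂ r′  = contradiction r′ (Son-acyclic s)

leftSon-son : ∀ a → Son a (leftSon a)
leftSon-son a = 1 , inj₁ left

RightEdge-unique : ∀ {a l b l′ b′} → RightEdge a l b → RightEdge a l′ b′ → l ≡ l′ × b ≡ b′
RightEdge-unique (right _) (right _) = refl , refl

RightEdge⇒HasRightSon : ∀ {a l b} → RightEdge a l b → HasRightSon a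
RightEdge⇒HasRightSon (right h) = h

left-right-disjoint : ∀ {a n d b} → RightEdge a (suc (suc n)) d →
                      Star Son (leftSon a) b → ¬ Star Son d b
left-right-disjoint {a} {n} {d} e r r′ = distinct (equal (ancestors-comparable r r′))
  where
  s : Son a d
  s = _ , inj₂ e

  equal : Star Son (leftSon a) d ⊎ Star Son d (leftSon a) → leftSon a ≡ d
  equal (inj₁ q) = siblings-comparable⇒≡ (leftSon-son a) s q
  equal (inj₂ q) = sym (siblings-comparable⇒≡ s (leftSon-son a) q)

  distinct : leftSon a ≢ d
  distinct refl with () ← EdgeOf-label (inj₁ (left {a})) (inj₂ e)

-- Whole subtrees and left subtrees

Star-split : ∀ {a b} → Star Son a b →
  Node (withLeftSubtree a) b ⊎ (∃[ l ] ∃[ d ] RightEdge a l d × Star Son d b)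
Star-split ε                     = inj₁ (inj₁ refl)
Star-split ((_ , inj₁ left) ◅ r) = inj₁ (inj₂ r)
Star-split ((l , inj₂ e) ◅ r)    = inj₂ (l , _ , e , r)

withLeft⇒Star : ∀ {a b} → Node (withLeftSubtree a) b → Star Son a b
withLeft⇒Star (inj₁ refl) = ε
withLeft⇒Star (inj₂ r)    = leftSon-son _ ◅ r

¬hasRightSon⇒whole⇔withLeft-node : ∀ {a b} → ¬ HasRightSon a →
  Node (wholeSubtree a) b ⇔ Node (withLeftSubtree a) b
¬hasRightSon⇒whole⇔withLeft-node {a} {b} ¬h = mk⇔ to withLeft⇒Star
  where
  to : Star Son a b → Node (withLeftSubtree a) b
  to r with Star-split r
  ... | inj₁ z               = z
  ... | inj₂ (_ , _ , e , _) = contradiction (RightEdge⇒HasRightSon e) ¬h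

¬hasRightSon⇒whole⇔withLeft-edge : ∀ {a b l d} → ¬ HasRightSon a →
  Edge (wholeSubtree a) b l d ⇔ Edge (withLeftSubtree a) b l d
¬hasRightSon⇒whole⇔withLeft-edge {a} {b} {l} {d} ¬h = mk⇔ to from
  where
  to : Edge (wholeSubtree a) b l d → Edge (withLeftSubtree a) b l d
  to (r , e) with Equivalence.to (¬hasRightSon⇒whole⇔withLeft-node ¬h) r | e
  ... | inj₂ r′   | _       = inj₂ (r′ , e)
  ... | inj₁ refl | inj₁ le = inj₁ (refl , le)
  ... | inj₁ refl | inj₂ re = contradiction (RightEdge⇒HasRightSon re) ¬h

  from : Edge (withLeftSubtree a) b l d → Edge (wholeSubtree a) b l d
  from (inj₁ (refl , e)) = ε , inj₁ e
  from (inj₂ (r , e))    = leftSon-son a ◅ r , e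

-- Without a right son the whole subtree is already the root with its left subtree, so later
-- arguments can treat both branches of `X` as `withLeftSubtree`.
X-node : ∀ n a b → Node (X (suc n) a) b ⇔ Node (withLeftSubtree a) b
X-node n a b = go (hasRightSon? a)
  where
  -- The decision is made a variable, so that matching on it reduces the `if`.
  go : (h : Dec (HasRightSon a)) →
       Node (if does h then withLeftSubtree a else wholeSubtree a) b ⇔ Node (withLeftSubtree a) b
  go (yes _) = ⇔-id _
  go (no ¬h) = ¬hasRightSon⇒whole⇔withLeft-node ¬h

X-edge : ∀ n a b l d → Edge (X (suc n) a) b l d ⇔ Edge (withLeftSubtree a) b l d
X-edge n a b l d = go (hasRightSon? a)
  where
  go : (h : Dec (HasRightSon a)) →
       Edge (if does h then withLeftSubtree a else wholeSubtree a) b l d ⇔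
       Edge (withLeftSubtree a) b l d
  go (yes _) = ⇔-id _
  go (no ¬h) = ¬hasRightSon⇒whole⇔withLeft-edge ¬h

-- The chain

-- Made total by staying at `a` when there is no right son, so that the chain can be a sequence
-- indexed by `ℕ`.
next : Partition → Partition
next a with hasRightSon? a
... | yes h = rightSon a h
... | no _  = a

next-edge : ∀ {a} → HasRightSon a → RightEdge a (suc (#max a)) (next a)
next-edge {a} h with hasRightSon? a
... | yes h′ = right h′
... | no ¬h  = contradiction h ¬h

module Chain {n : ℕ} {a : Partition} (root : IsXRoot (suc n) a) where

  i : ℕ
  i = proj₁ (proj₂ root)

  -- d m is the node number m + 2 of the chain.
  d : ℕ → Partition
  d zero    = leftSon a
  d (suc m) = next (d m)

  -- The invariant of the chain, stated for lists so that it can be carried along `_↓_`. The middle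
  -- range is empty when `m` is `n`.
  Raised : ℕ → List ℕ → Set
  Raised m xs = (∀ t → 1 ≤ t → t ≤ suc m → part xs t ≡ suc i)
              × (∀ t → suc m < t → t ≤ suc n → part xs t ≡ i)
              × part xs (suc (suc n)) < i

  -- For `m < n` the block ends with the drop from `i + 1` to `i`; for `m ≡ n` it ends at the
  -- original drop below `i`.
  raised-shape : ∀ {m b} → m ≤ n → Raised m (parts b) → XShape (suc m) b
  raised-shape {m} m≤n (up , mid , lt) with m≤n⇒m<n∨m≡n m≤n
  ... | inj₁ m<n  = suc i , up , s≤s (≤-reflexive (mid (suc (suc m)) ≤-refl (s≤s m<n)))
  ... | inj₂ refl = suc i , up , m<n⇒m<1+n lt

  raised-hasRightSon : ∀ {m b} → m < n → Raised m (parts b) → HasRightSon b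
  raised-hasRightSon {m} {b} m<n R@(up , mid , lt)
    rewrite XShape⇒#max b (raised-shape {b = b} (<⇒≤ m<n) R)
          | up (suc m) z<s ≤-refl | mid (suc (suc m)) ≤-refl (s≤s m<n) =
    XShape-suc-nonempty {a = b} (raised-shape {b = b} (<⇒≤ m<n) R) , m+n∸n≡m 1 i

  -- Past the raised block comes a part less than `i`, so the gap from `i + 1` is at least 2.
  raised-¬hasRightSon : ∀ {b} → Raised n (parts b) → ¬ HasRightSon b
  raised-¬hasRightSon {b} R@(up , mid , lt) (_ , e)
    rewrite XShape⇒#max b (raised-shape {b = b} ≤-refl R)
          | up (suc n) z<s ≤-refl = contradiction (sym e) (<⇒≢ gap)
    where
    gap : 1 < suc i ∸ part (parts b) (suc (suc n))
    gap = ≤-trans (s≤s (m<n⇒0<n∸m lt)) (≤-reflexive (sym (+-∸-assoc 1 (<⇒≤ lt))))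

  raised-edge : ∀ {m b} → m < n → Raised m (parts b) →
                RightEdge b (suc (suc m)) (next b)
  raised-edge {m} {b} m<n R =
    subst (λ p → RightEdge b (suc p) (next b))
      (XShape⇒#max b (raised-shape {b = b} (<⇒≤ m<n) R))
      (next-edge (raised-hasRightSon {b = b} m<n R))

  raised-↓ : ∀ {m} xs → m < n → Raised m xs → Raised (suc m) (xs ↓ suc (suc m))
  raised-↓ {m} xs m<n (up , mid , lt) =
    up′ ,
    (λ t m<t t≤n → trans (part-↓-other xs (suc m) (>⇒≢ m<t))
                         (mid t (<-trans ≤-refl m<t) t≤n)) ,
    ≤-<-trans (≤-reflexive (part-↓-other xs (suc m) (>⇒≢ (s≤s (s≤s m<n))))) lt
    where
    up′ : ∀ t → 1 ≤ t → t ≤ suc (suc m) → part (xs ↓ suc (suc m)) t ≡ suc i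
    up′ t 1≤t t≤ with t ≟ suc (suc m)
    ... | yes refl = trans (part-↓-same xs (suc m)) (cong suc (mid t ≤-refl (s≤s m<n)))
    ... | no t≢    = trans (part-↓-other xs (suc m) t≢) (up t 1≤t (≤-pred (≤∧≢⇒< t≤ t≢)))

  d-raised : ∀ m → m ≤ n → Raised m (parts (d m))
  d-raised zero _ with proj₂ root
  ... | i , eq , lt =
    (λ { (suc zero) _ _ → trans (part-↓-same xs 0) (cong suc (eq 1 z<s z<s))
       ; (suc (suc _)) _ (s≤s ()) }) ,
    (λ t 1<t t≤ → trans (part-↓-other xs 0 (>⇒≢ 1<t)) (eq t (<⇒≤ 1<t) t≤)) ,
    ≤-<-trans (≤-reflexive (part-↓-other xs 0 λ ())) lt
    where xs = parts a
  d-raised (suc m) m<n =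
    subst (Raised (suc m)) (sym (EdgeOf-parts (inj₂ (raised-edge {b = d m} m<n R))))
      (raised-↓ (parts (d m)) m<n R)
    where R = d-raised m (<⇒≤ m<n)

  d-edge : ∀ {m} → m < n → RightEdge (d m) (suc (suc m)) (d (suc m))
  d-edge {m} m<n = raised-edge {b = d m} m<n (d-raised _ (<⇒≤ m<n))

  d-end : ¬ HasRightSon (d n)
  d-end = raised-¬hasRightSon {d n} (d-raised n ≤-refl)

  d-path : ∀ m {p} → m + p ≤ n → Star Son (d p) (d (m + p))
  d-path zero    le = ε
  d-path (suc m) le = d-path m (<⇒≤ le) ◅◅ ((_ , inj₂ (d-edge le)) ◅ ε)

  d-≤-path : ∀ {p m} → p ≤ m → m ≤ n → Star Son (d p) (d m)
  d-≤-path {p} {m} p≤m m≤n =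
    subst (Star Son (d p) ∘ d) (m∸n+n≡m p≤m)
      (d-path (m ∸ p) (≤-trans (≤-reflexive (m∸n+n≡m p≤m)) m≤n))

  -- `q` counts the chain nodes still below `d m`. A path from `d m` stops there, enters the left
  -- subtree, or enters the right son, which is `d (suc m)`; at `d n` the last case cannot occur.
  d-cover : ∀ q m {b} → q + m ≡ n → Star Son (d m) b →
            ∃[ p ] p ≤ n × Node (withLeftSubtree (d p)) b
  d-cover q m e r with Star-split r
  d-cover q m e r       | inj₁ z = m , ≤-trans (m≤n+m m q) (≤-reflexive e) , z
  d-cover zero m refl r | inj₂ (_ , _ , re , _) =
    contradiction (RightEdge⇒HasRightSon re) d-end
  d-cover (suc q) m refl r | inj₂ (_ , _ , re , r′)
    with refl ← proj₂ (RightEdge-unique re (d-edge (s≤s (m≤n+m m q)))) =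
    d-cover q (suc m) (+-suc q m) r′

  -- `d m` lies in the right subtree of `d p`, so its descendants are neither `d p` itself (by
  -- acyclicity) nor below the left son of `d p`.
  d-disjoint : ∀ {p m b} → p < m → m ≤ n → Node (withLeftSubtree (d p)) b →
               ¬ Node (withLeftSubtree (d m)) b
  d-disjoint p<m m≤n z z′ with d-edge (<-≤-trans p<m m≤n)
  d-disjoint p<m m≤n (inj₁ refl) z′ | e =
    Son-acyclic (_ , inj₂ e) (d-≤-path p<m m≤n ◅◅ withLeft⇒Star z′)
  d-disjoint p<m m≤n (inj₂ r) z′    | e =
    left-right-disjoint e r (d-≤-path p<m m≤n ◅◅ withLeft⇒Star z′)

  -- The pieces rooted at the chain nodes

  c : Fin (suc (suc n)) → Partition
  c zero    = a
  c (suc j) = d (toℕ j)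

  c-root : ∀ j → IsXRoot (toℕ j) (c j)
  c-root zero    = proj₁ root , tt
  c-root (suc j) =
    proj₁ root ◅◅ (leftSon-son a ◅ d-≤-path z≤n j≤n) ,
    raised-shape {b = d (toℕ j)} j≤n (d-raised (toℕ j) j≤n)
    where j≤n = toℕ≤pred[n] j

  c-cover : ∀ {b} → Star Son (leftSon a) b → ∃[ j ] Node (withLeftSubtree (d (toℕ {suc n} j))) b
  -- The left son of `a` is `d 0`, with `n` further chain nodes below it.
  c-cover r with d-cover n 0 (+-identityʳ n) r
  ... | p , p≤n , z = fromℕ< (s≤s p≤n) ,
    subst (λ p → Node (withLeftSubtree (d p)) _) (sym (toℕ-fromℕ< (s≤s p≤n))) z

  c-path : ∀ (j : Fin (suc n)) → Star Son (leftSon a) (c (suc j))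
  c-path j = d-≤-path z≤n (toℕ≤pred[n] j)

  c-step : ∀ (j : Fin (suc n)) →
           ChainStep (toℕ j) (c (inject₁ j)) (suc (toℕ j)) (c (suc j))
  c-step zero = left
  c-step (suc j) rewrite toℕ-inject₁ j = d-edge (toℕ<n j)

  -- The piece at index 0 contributes `a` alone; the left subtree of `a` is shared out among the
  -- others.
  nodes : ∀ b → Node (X (suc n) a) b ⇔ (∃[ j ] Node (X (toℕ j) (c j)) b)
  nodes b = mk⇔ (to ∘ Equivalence.to (X-node n a b)) (Equivalence.from (X-node n a b) ∘ from)
    where
    to : Node (withLeftSubtree a) b → ∃[ j ] Node (X (toℕ j) (c j)) b
    to (inj₁ b≡a) = zero , b≡a
    to (inj₂ r)   = let j , z = c-cover r in
                    suc j , Equivalence.from (X-node (toℕ j) (c (suc j)) b) z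

    from : (∃[ j ] Node (X (toℕ j) (c j)) b) → Node (withLeftSubtree a) b
    from (zero , b≡a) = inj₁ b≡a
    from (suc j , z)  =
      inj₂ (c-path j ◅◅ withLeft⇒Star (Equivalence.to (X-node (toℕ j) (c (suc j)) b) z))

  -- The later pieces lie in the left subtree of `a`, so containing `a` would close a cycle.
  root-disjoint : ∀ j → ¬ Node (X (suc (toℕ j)) (c (suc j))) a
  root-disjoint j z =
    Son-acyclic (leftSon-son a)
      (c-path j ◅◅ withLeft⇒Star (Equivalence.to (X-node (toℕ j) (c (suc j)) a) z))

  disjoint : ∀ j j′ b → Node (X (toℕ j) (c j)) b → Node (X (toℕ j′) (c j′)) b → j ≡ j′
  disjoint zero    zero     b z    z′   = refl
  disjoint zero    (suc j′) b refl z′   = contradiction z′ (root-disjoint j′)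
  disjoint (suc j) zero     b z    refl = contradiction z (root-disjoint j)
  disjoint (suc j) (suc j′) b z    z′   with <-cmp (toℕ j) (toℕ j′)
                                           | Equivalence.to (X-node (toℕ j) (c (suc j)) b) z
                                           | Equivalence.to (X-node (toℕ j′) (c (suc j′)) b) z′
  ... | tri≈ _ e _ | _ | _  = cong suc (toℕ-injective e)
  ... | tri< q _ _ | w | w′ = contradiction w′ (d-disjoint q (toℕ≤pred[n] j′) w)
  ... | tri> _ _ q | w | w′ = contradiction w (d-disjoint q (toℕ≤pred[n] j) w′)

  -- Edges are sorted by the piece containing their upper end. An edge stays in that piece unless it
  -- is the left edge of `a` or the right edge of a later chain node; those are the chain edges.
  edges : ∀ b l b′ → Edge (X (suc n) a) b l b′ ⇔
    ((∃[ j ] Edge (X (toℕ j) (c j)) b l b′)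
     ⊎ (∃ λ (j : Fin (suc n)) → b ≡ c (inject₁ j) × l ≡ suc (toℕ j) × b′ ≡ c (suc j)))
  edges b l b′ =
    mk⇔ (to ∘ Equivalence.to (X-edge n a b l b′)) (Equivalence.from (X-edge n a b l b′) ∘ from)
    where
    Pieces : Set
    Pieces = (∃[ j ] Edge (X (toℕ j) (c j)) b l b′)
      ⊎ (∃ λ (j : Fin (suc n)) → b ≡ c (inject₁ j) × l ≡ suc (toℕ j) × b′ ≡ c (suc j))

    inPiece : ∀ j → Edge (withLeftSubtree (c (suc j))) b l b′ → Pieces
    inPiece j z = inj₁ (suc j , Equivalence.from (X-edge (toℕ j) (c (suc j)) b l b′) z)

    rightEdge : ∀ {m} → m ≤ n → RightEdge (d m) l b′ →
      ∃ λ (j : Fin (suc n)) → d m ≡ c (inject₁ j) × l ≡ suc (toℕ j) × b′ ≡ c (suc j)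
    rightEdge {m} m≤n e with m≤n⇒m<n∨m≡n m≤n
    ... | inj₂ refl = contradiction (RightEdge⇒HasRightSon e) d-end
    -- `d m` has index `m + 1` in `c`, so its right edge is the chain edge with index `suc j`, where
    -- `toℕ j` equals `m`.
    ... | inj₁ m<n  with refl , refl ← RightEdge-unique e (d-edge m<n) =
      suc j , cong d (sym (trans (toℕ-inject₁ j) j≡m)) ,
      cong (λ p → suc (suc p)) (sym j≡m) , cong (λ p → d (suc p)) (sym j≡m)
      where
      j   = fromℕ< m<n
      j≡m = toℕ-fromℕ< m<n

    to : Edge (withLeftSubtree a) b l b′ → Pieces
    to (inj₁ (refl , left)) = inj₂ (zero , refl , refl , refl)
    to (inj₂ (r , e)) with c-cover r | e
    ... | j , inj₂ r′   | _       = inPiece j (inj₂ (r′ , e))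
    ... | j , inj₁ refl | inj₁ le = inPiece j (inj₁ (refl , le))
    ... | j , inj₁ refl | inj₂ re = inj₂ (rightEdge (toℕ≤pred[n] j) re)

    from : Pieces → Edge (withLeftSubtree a) b l b′
    from (inj₁ (zero , ()))
    from (inj₁ (suc j , z)) with Equivalence.to (X-edge (toℕ j) (c (suc j)) b l b′) z
    ... | inj₁ (refl , e) = inj₂ (c-path j , inj₁ e)
    ... | inj₂ (r , e)    = inj₂ (c-path j ◅◅ (leftSon-son _ ◅ r) , e)
    from (inj₂ (zero , refl , refl , refl))  = inj₁ (refl , left)
    from (inj₂ (suc j , refl , refl , refl)) =
      inj₂ (d-≤-path z≤n (≤-trans (≤-reflexive (toℕ-inject₁ j)) (<⇒≤ (toℕ<n j)))
           , inj₂ (c-step (suc j)))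

  rightmost : IsRightmostChain (X (suc n) a) a c
  rightmost = record
    { start  = refl
    ; step   = c-step
    ; inside = λ j → Equivalence.from (edges _ _ _) (inj₂ (j , refl , refl , refl))
    -- The last chain node has no right son anywhere in the tree; `toℕ-fromℕ` identifies it with
    -- `d n`.
    ; end    = λ l b e _ → d-end (subst (HasRightSon ∘ d) (toℕ-fromℕ n) (RightEdge⇒HasRightSon e))
    }

proposition6 : ∀ (k : ℕ) → 1 ≤ k → (a : Partition) → IsXRoot k a →
    ∃ λ (c : Fin (suc k) → Partition) →
    IsRightmostChain (X k a) a c
    × (∀ (i : Fin (suc k)) → IsXRoot (toℕ i) (c i))
    × (∀ b → Node (X k a) b ⇔ (∃[ i ] Node (X (toℕ i) (c i)) b))
    × (∀ i j b → Node (X (toℕ i) (c i)) b → Node (X (toℕ j) (c j)) b → i ≡ j)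
    × (∀ b l d → Edge (X k a) b l d ⇔
    ((∃[ i ] Edge (X (toℕ i) (c i)) b l d)
    ⊎ (∃ λ (j : Fin k) → b ≡ c (inject₁ j) × l ≡ suc (toℕ j) × d ≡ c (suc j))))
proposition6 (suc n) _ a root = c , rightmost , c-root , nodes , disjoint , edges
  where open Chain root
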